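{- Let $K_n$ be a complete graph. Then $\mathrm{mpd}(K_n)=\infty$.
   Context: $K_n$ denotes the complete graph with $n$ vertices. $d(u,v)$ denotes the shortest-path distance. Let $G$ be a graph and let $\Pi=\{S_1,\dots,S_t\}$ be a partition of $V(G)$. For $v\in V(G)$ put $d(v,S_i)=\min\{d(v,x):x\in S_i\}$. The multiset partition representation of $v$ with respect to $\Pi$ is the multiset $r_{mp}(v\mid\Pi)=\{d(v,S_1),\dots,d(v,S_t)\}$ (order ignored, multiplicities kept). $\Pi$ is a resolving multiset partition if $r_{mp}(u\mid\Pi)\ne r_{mp}(v\mid\Pi)$ for all distinct $u,v\in V(G)$. The multiset partition dimension $\mathrm{mpd}(G)$ is the minimum number $t$ of parts of a resolving multiset partition of $G$, and $\mathrm{mpd}(G)=\infty$ if no resolving multiset partition exists.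
   Formalization: The formal statement assumes n ≥ 2, since for the one-vertex graph K_1 the one-part partition is vacuously resolving, so mpd(K_1) = 1 and the claim as written fails there. -}

module Defs where

open import Data.Fin.Base using (Fin; zero; suc; toℕ)
open import Data.Fin.Properties as Fin
  using (any?; all?; pigeonhole; injective⇒≤; toℕ≤pred[n])
open import Data.Fin.Subset using (Subset; Nonempty; _∈_)
open import Data.Fin.Subset.Properties using (_∈?_; nonempty?; anySubset?)
open import Data.List.Base using (List; []; _∷_; _++_; map; filter; allFin; upTo)
import Data.List.Extrema as Extrema
open import Data.List.Membership.Propositional using () renaming (_∈_ to _∈ˡ_)
open import Data.List.Membership.Propositional.Properties
  using (∈-map⁺; ∈-map⁻; ∈-filter⁺; ∈-filter⁻; ∈-upTo⁺; ∈-∃++)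
import Data.List.Membership.DecPropositional as DecMembership
open import Data.List.Relation.Binary.Permutation.Propositional
  using (_↭_; prep; ↭-refl; ↭-sym; ↭-trans)
open import Data.List.Relation.Binary.Permutation.Propositional.Properties
  using (∈-resp-↭; ↭-length; shift; drop-∷)
import Data.List.Relation.Unary.All as All
open import Data.List.Relation.Unary.Any using (here; there)
open import Data.Nat.Base using (ℕ; zero; suc; _+_; _∸_; _≤_; _<_; s≤s)
open import Data.Nat.Induction using (<-rec)
import Data.Nat.Properties as ℕ
open import Data.Product.Base using (∃; _×_; _,_; proj₁; proj₂)
open import Data.Sum.Base using (inj₁; inj₂)
open import Data.Vec.Base using (Vec; []; _∷_; lookup; toList)
open import Level using (0ℓ)
open import Relation.Binary.Bundles using (TotalOrder)
open import Relation.Binary.Construct.Add.Supremum.NonStrict _≤_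
  using (_≤⁺_; ≤⁺-isTotalOrder-≡)
open import Relation.Binary.Definitions using () renaming (Decidable to Decidable₂)
open import Relation.Binary.PropositionalEquality.Core
  using (_≡_; _≢_; refl; sym; trans; subst)
open import Relation.Nullary.Construct.Add.Supremum using (_⁺; ⊤⁺; [_]; ≡-dec)
open import Relation.Nullary.Decidable
  using (Dec; yes; no; map′; ¬?; _×-dec_; _→-dec_)
open import Relation.Nullary.Negation using (¬_; contradiction)
open import Relation.Unary using (Pred; Decidable)

------------------------------------------------------------------------
-- Natural numbers with infinity

ℕ∞ : Set
ℕ∞ = ℕ ⁺

∞ : ℕ∞
∞ = ⊤⁺

_≟∞_ : Decidable₂ {A = ℕ∞} _≡_
_≟∞_ = ≡-dec ℕ._≟_

≤∞-totalOrder : TotalOrder 0ℓ 0ℓ 0ℓ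
≤∞-totalOrder = record { isTotalOrder = ≤⁺-isTotalOrder-≡ ℕ.≤-isTotalOrder }

-- The minimum of a list, with the convention min ∅ = ∞.
minimum : List ℕ∞ → ℕ∞
minimum = Extrema.min ≤∞-totalOrder ∞

-- The least k < b satisfying P, and ∞ if there is none.
least : {P : Pred ℕ 0ℓ} → Decidable P → ℕ → ℕ∞
least P? b = minimum (map [_] (filter P? (upTo b)))

least-sound : ∀ {P : Pred ℕ 0ℓ} (P? : Decidable P) b {k} → least P? b ≡ [ k ] → P k
least-sound P? b eq
  with Extrema.argmin-sel ≤∞-totalOrder (λ x → x) ∞ (map [_] (filter P? (upTo b)))
... | inj₁ min≡∞ = contradiction (trans (sym eq) min≡∞) λ ()
... | inj₂ min∈ with ∈-map⁻ [_] (subst (_∈ˡ map [_] (filter P? (upTo b))) eq min∈)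
...   | _ , k∈ , refl = proj₂ (∈-filter⁻ P? {xs = upTo b} k∈)

least-minimal : ∀ {P : Pred ℕ 0ℓ} (P? : Decidable P) b {k} → k < b → P k →
                least P? b ≤⁺ [ k ]
least-minimal P? b k<b pk =
  All.lookup (Extrema.min≤xs ≤∞-totalOrder ∞ (map [_] (filter P? (upTo b))))
    (∈-map⁺ [_] (∈-filter⁺ P? (∈-upTo⁺ k<b) pk))

------------------------------------------------------------------------
-- Finite simple graphs and shortest-path distance

record Graph (n : ℕ) : Set₁ where
  field
    Adj     : Fin n → Fin n → Set
    adj?    : Decidable₂ Adj
    symm    : ∀ {u v} → Adj u v → Adj v u
    irrefl  : ∀ {v} → ¬ Adj v v

complete : ∀ n → Graph n
complete n = record
  { Adj    = _≢_
  ; adj?   = λ u v → ¬? (u Fin.≟ v)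
  ; symm   = λ u≢v v≡u → u≢v (sym v≡u)
  ; irrefl = λ v≢v → v≢v refl
  }

module _ {n : ℕ} (G : Graph n) where
  open Graph G

  -- Walk k u v: a walk with k edges from u to v.
  data Walk : ℕ → Fin n → Fin n → Set where
    []  : ∀ {v} → Walk zero v v
    _∷_ : ∀ {k u w v} → Adj u w → Walk k w v → Walk (suc k) u v

  walk? : ∀ u v → Decidable (λ k → Walk k u v)
  walk? u v zero    = map′ (λ { refl → [] }) (λ { [] → refl }) (u Fin.≟ v)
  walk? u v (suc k) = map′ (λ { (_ , a , p) → a ∷ p }) (λ { (a ∷ p) → _ , a , p })
                        (any? λ w → adj? u w ×-dec walk? w v k)

  -- A shortest walk repeats no vertex, so it has fewer than n edges; hence
  -- bounding the search by n loses nothing (dist-minimal below).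
  -- The distance is ∞ between different components.
  dist : Fin n → Fin n → ℕ∞
  dist u v = least (walk? u v) n

  distToSet : Fin n → Subset n → ℕ∞
  distToSet v S = minimum (map (dist v) (filter (_∈? S) (allFin n)))

  private
    at : ∀ {k u v} → Walk k u v → Fin (suc k) → Fin n
    at {u = u} _   zero    = u
    at (_ ∷ p)     (suc i) = at p i

    prefix : ∀ {k u v} (p : Walk k u v) i → Walk (toℕ i) u (at p i)
    prefix p       zero    = []
    prefix (a ∷ p) (suc i) = a ∷ prefix p i

    suffix : ∀ {k u v} (p : Walk k u v) i → Walk (k ∸ toℕ i) (at p i) v
    suffix p       zero    = p
    suffix (a ∷ p) (suc i) = suffix p i

    join : ∀ {k l u w v} → Walk k u w → Walk l w v → Walk (k + l) u v
    join []      q = q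
    join (a ∷ p) q = a ∷ join p q

    shorten : ∀ {k u v} → n ≤ k → Walk k u v → ∃ λ l → l < k × Walk l u v
    shorten {k} {v = v} n≤k p with pigeonhole (s≤s n≤k) (at p)
    ... | i , j , i<j , eq =
      toℕ i + (k ∸ toℕ j) ,
      subst (toℕ i + (k ∸ toℕ j) <_) (ℕ.m+[n∸m]≡n (toℕ≤pred[n] j))
        (ℕ.+-monoˡ-< (k ∸ toℕ j) i<j) ,
      join (prefix p i) (subst (λ w → Walk _ w v) (sym eq) (suffix p j))

    short : ∀ {u v} k → Walk k u v → ∃ λ l → l < n × l ≤ k × Walk l u v
    short {u} {v} = <-rec _ λ k rec p → go k rec p
      where
      Goal : ℕ → Set
      Goal k = Walk k u v → ∃ λ l → l < n × l ≤ k × Walk l u v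
      go : ∀ k → (∀ {m} → m < k → Goal m) → Goal k
      go k rec p with k ℕ.<? n
      ... | yes k<n = k , k<n , ℕ.≤-refl , p
      ... | no  k≮n with shorten (ℕ.≮⇒≥ k≮n) p
      ...   | m , m<k , q with rec m<k q
      ...     | l , l<n , l≤m , r = l , l<n , ℕ.≤-trans l≤m (ℕ.<⇒≤ m<k) , r

  dist-walk : ∀ {u v k} → dist u v ≡ [ k ] → Walk k u v
  dist-walk {u} {v} = least-sound (walk? u v) n

  dist-minimal : ∀ {u v k} → Walk k u v → dist u v ≤⁺ [ k ]
  dist-minimal {u} {v} {k} p with short k p
  ... | l , l<n , l≤k , q =
    TotalOrder.trans ≤∞-totalOrder (least-minimal (walk? u v) n l<n q) _≤⁺_.[ l≤k ]

------------------------------------------------------------------------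
-- Partitions

-- The parts are listed in some order, which is immaterial to everything below.
record IsPartition {n t : ℕ} (Π : Vec (Subset n) t) : Set where
  field
    nonempty : ∀ i → Nonempty (lookup Π i)
    covers   : ∀ v → ∃ λ i → v ∈ lookup Π i
    disjoint : ∀ i j v → v ∈ lookup Π i → v ∈ lookup Π j → i ≡ j

isPartition? : ∀ {n t} → Decidable (IsPartition {n} {t})
isPartition? Π =
  map′ (λ { (a , b , c) → record { nonempty = a ; covers = b ; disjoint = c } })
       (λ P → let open IsPartition P in nonempty , covers , disjoint)
    (all? (λ i → nonempty? (lookup Π i))
     ×-dec all? (λ v → any? λ i → v ∈? lookup Π i)
     ×-dec all? (λ i → all? λ j → all? λ v →
       v ∈? lookup Π i →-dec v ∈? lookup Π j →-dec i Fin.≟ j))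

partition⇒≤ : ∀ {n t} {Π : Vec (Subset n) t} → IsPartition Π → t ≤ n
partition⇒≤ {Π = Π} P = injective⇒≤ {f = λ i → proj₁ (nonempty i)} λ {i} {j} eq →
  disjoint i j _ (proj₂ (nonempty i))
    (subst (_∈ lookup Π j) (sym eq) (proj₂ (nonempty j)))
  where open IsPartition P

------------------------------------------------------------------------
-- Finite multisets are lists up to permutation

_↭?_ : Decidable₂ {A = List ℕ∞} _↭_
[]       ↭? []       = yes ↭-refl
[]       ↭? (y ∷ ys) = no λ p → contradiction (↭-length p) λ ()
(x ∷ xs) ↭? ys with DecMembership._∈?_ _≟∞_ x ys
... | no  x∉ys = no λ p → x∉ys (∈-resp-↭ p (here refl))
... | yes x∈ys with ∈-∃++ x∈ys
...   | as , bs , refl =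
  map′ (λ p → ↭-trans (prep x p) (↭-sym (shift x as bs)))
       (λ p → drop-∷ (↭-trans p (shift x as bs)))
       (xs ↭? (as ++ bs))

------------------------------------------------------------------------
-- Multiset partition dimension

anyVec? : ∀ {n} t {P : Pred (Vec (Subset n) t) 0ℓ} → Decidable P → Dec (∃ P)
anyVec? zero    P? = map′ (λ p → [] , p) (λ { ([] , p) → p }) (P? [])
anyVec? (suc t) P? =
  map′ (λ { (S , Π , p) → S ∷ Π , p }) (λ { (S ∷ Π , p) → S , Π , p })
    (anySubset? λ S → anyVec? t λ Π → P? (S ∷ Π))

module _ {n : ℕ} (G : Graph n) where

  representation : ∀ {t} → Fin n → Vec (Subset n) t → List ℕ∞
  representation v Π = map (distToSet G v) (toList Π)

  Resolving : ∀ {t} → Vec (Subset n) t → Set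
  Resolving Π = ∀ u v → u ≢ v → ¬ (representation u Π ↭ representation v Π)

  HasResolvingPartition : ℕ → Set
  HasResolvingPartition t = ∃ λ (Π : Vec (Subset n) t) → IsPartition Π × Resolving Π

  hasResolvingPartition? : Decidable HasResolvingPartition
  hasResolvingPartition? t = anyVec? t λ Π → isPartition? Π ×-dec
    all? λ u → all? λ v →
      ¬? (u Fin.≟ v) →-dec ¬? (representation u Π ↭? representation v Π)

  -- Parts are nonempty, so there are at most n of them, and bounding the search
  -- by n loses nothing (mpd-minimal below).
  mpd : ℕ∞
  mpd = least hasResolvingPartition? (suc n)

  mpd-attained : ∀ {t} → mpd ≡ [ t ] → HasResolvingPartition t
  mpd-attained = least-sound hasResolvingPartition? (suc n)

  mpd-minimal : ∀ {t} → HasResolvingPartition t → mpd ≤⁺ [ t ]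
  mpd-minimal r@(_ , P , _) =
    least-minimal hasResolvingPartition? (suc n) (s≤s (partition⇒≤ P)) r

{-# OPTIONS --safe #-}

-- In a complete graph every vertex is at distance 0 from its own part and at
-- distance 1 from every other part, so all vertices have the same
-- representation {0, 1, …, 1}, and two distinct vertices are never resolved.

module Submission where

open import Defs
open import Data.Fin.Base using (Fin; zero; suc)
open import Data.Fin.Properties using (suc-injective)
open import Data.Fin.Subset using (Subset; Nonempty; _∈_; _∉_)
open import Data.Fin.Subset.Properties using (_∈?_)
open import Data.List.Base as List using ([]; _∷_; filter; allFin)
import Data.List.Extrema as Extrema
open import Data.List.Membership.Propositional using () renaming (_∈_ to _∈ˡ_)
open import Data.List.Membership.Propositional.Properties
  using (∈-map⁺; ∈-map⁻; ∈-filter⁺; ∈-filter⁻; ∈-allFin)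
open import Data.List.Relation.Binary.Permutation.Propositional
  using (_↭_; prep; swap; refl; ↭-sym; ↭-trans; ↭-reflexive)
import Data.List.Relation.Unary.All as All
open import Data.Nat.Base using (ℕ; zero; suc; _≤_; z≤n; s≤s)
open import Data.Product.Base using (_,_; proj₁; proj₂)
open import Data.Vec.Base using (Vec; []; _∷_; lookup; map; toList)
open import Data.Vec.Properties using (lookup-map; toList-map)
open import Function.Base using (_∘_)
open import Relation.Binary.Bundles using (TotalOrder)
open import Relation.Binary.Construct.Add.Supremum.NonStrict _≤_ using (_≤⁺_; [_]; _≤⊤⁺)
open import Relation.Binary.PropositionalEquality.Core
  using (_≡_; _≢_; refl; sym; trans; cong₂; subst)
open import Relation.Nullary.Construct.Add.Supremum using (⊤⁺; [_])
open import Relation.Nullary.Negation using (¬_; contradiction)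

minimum-≡ : ∀ {x xs} → x ∈ˡ xs → (∀ {y} → y ∈ˡ xs → x ≤⁺ y) → minimum xs ≡ x
-- The last argument deals with the default value `∞` of `minimum`, which lies above every element.
minimum-≡ x∈xs x≤ = Extrema.min≈v⁺ ≤∞-totalOrder x∈xs (All.tabulate x≤) (_ ≤⊤⁺)

-- The position `i` of the exceptional entry varies with the vertex; sorting it to the front gives a
-- normal form without `i`. Induction on `i` moves `a` forward one swap at a time.
toList-↭ : ∀ {A : Set} {a b : A} {t} (xs : Vec A (suc t)) i →
           lookup xs i ≡ a → (∀ j → j ≢ i → lookup xs j ≡ b) →
           toList xs ↭ a ∷ List.replicate t b
toList-↭ {b = b} (x ∷ xs) zero refl others =
  prep x (↭-reflexive (constant xs λ j → others (suc j) λ ()))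
  where
  constant : ∀ {t} (xs : Vec _ t) → (∀ j → lookup xs j ≡ b) →
             toList xs ≡ List.replicate t b
  constant []       _  = refl
  constant (x ∷ xs) eq = cong₂ _∷_ (eq zero) (constant xs (eq ∘ suc))
-- Splitting `xs` shows that `t` is a successor, so that `replicate` unfolds and supplies the `b`
-- with which `x` is identified.
toList-↭ (x ∷ xs@(_ ∷ _)) (suc i) eq others with refl ← others zero (λ ()) =
  ↭-trans
    (prep x (toList-↭ xs i eq λ j j≢i → others (suc j) (j≢i ∘ suc-injective)))
    (swap x _ refl)

module _ {n : ℕ} where

  private
    K = complete n

  dist-self : ∀ v → dist K v v ≡ [ 0 ]
  dist-self v with dist K v v | dist-minimal K {v} []
  ... | [ .0 ] | [ z≤n ] = refl

  -- The single edge bounds the distance by 1, and a walk with no edges would force `u` and `v` to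
  -- coincide.
  dist-distinct : ∀ {u v} → u ≢ v → dist K u v ≡ [ 1 ]
  dist-distinct {u} {v} u≢v
    with dist K u v in eq | dist-minimal K {u} {v} (u≢v ∷ [])
  ... | [ 1 ] | _ = refl
  ... | [ suc (suc _) ] | [ s≤s () ]
  ... | [ 0 ] | _ with dist-walk K eq
  ...   | [] = contradiction refl u≢v

  distToSet-≡ : ∀ {v x S d} → x ∈ S → dist K v x ≡ d →
                (∀ {y} → y ∈ S → d ≤⁺ dist K v y) → distToSet K v S ≡ d
  distToSet-≡ {v} {x} {S} x∈S refl d≤ = minimum-≡
    (∈-map⁺ (dist K v) (∈-filter⁺ (_∈? S) (∈-allFin x) x∈S))
    λ z∈ → let _ , y∈ , z≡ = ∈-map⁻ (dist K v) z∈ in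
      subst (_ ≤⁺_) (sym z≡) (d≤ (proj₂ (∈-filter⁻ (_∈? S) {xs = allFin n} y∈)))

  distToSet-∈ : ∀ {v S} → v ∈ S → distToSet K v S ≡ [ 0 ]
  distToSet-∈ {v} v∈S = distToSet-≡ v∈S (dist-self v) λ _ → 0≤ _
    where
    0≤ : ∀ d → [ 0 ] ≤⁺ d
    0≤ [ _ ] = [ z≤n ]
    0≤ ⊤⁺    = _ ≤⊤⁺

  -- All of `S` differs from `v`, so every distance involved is 1. Nonemptiness keeps the minimum
  -- from being the default `∞`.
  distToSet-∉ : ∀ {v S} → Nonempty S → v ∉ S → distToSet K v S ≡ [ 1 ]
  distToSet-∉ {v} {S} (x , x∈S) v∉S = distToSet-≡ x∈S (dist-distinct (v≢ x∈S))
    λ y∈S → TotalOrder.reflexive ≤∞-totalOrder (sym (dist-distinct (v≢ y∈S)))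
    where
    v≢ : ∀ {y} → y ∈ S → v ≢ y
    v≢ y∈S refl = v∉S y∈S

  -- The right-hand side does not mention `v`. `covers` yields the part holding `v`, and `disjoint`
  -- keeps `v` out of the others.
  representation-complete : ∀ {t} {Π : Vec (Subset n) (suc t)} → IsPartition Π → ∀ v →
    representation K v Π ↭ [ 0 ] ∷ List.replicate t [ 1 ]
  representation-complete {Π = Π} P v with i , v∈Πi ← IsPartition.covers P v =
    subst (_↭ _) (toList-map (distToSet K v) Π)
      (toList-↭ (map (distToSet K v) Π) i
        (trans (lookup-map i _ Π) (distToSet-∈ v∈Πi))
        λ j j≢i → trans (lookup-map j _ Π)
          (distToSet-∉ (nonempty j) λ v∈Πj → j≢i (disjoint j i v v∈Πj v∈Πi)))
    where open IsPartition P

¬finite⇒∞ : ∀ {d} → (∀ t → d ≢ [ t ]) → d ≡ ∞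
¬finite⇒∞ {⊤⁺}    _       = refl
¬finite⇒∞ {[ t ]} ¬finite = contradiction refl (¬finite t)

complete-unresolvable : ∀ {n} {u v : Fin n} → u ≢ v → ∀ t →
                        ¬ HasResolvingPartition (complete n) t
-- With no parts at all, `u` cannot be covered.
complete-unresolvable {u = u} _ zero ([] , P , _) with () ← proj₁ (IsPartition.covers P u)
complete-unresolvable {u = u} {v} u≢v (suc t) (Π , P , resolving) = resolving u v u≢v
  (↭-trans (representation-complete P u) (↭-sym (representation-complete P v)))

theorem4p1 : (n : ℕ) → 2 ≤ n → mpd (complete n) ≡ ∞
-- Matching on `2 ≤ n` exposes two distinct vertices, `zero` and `suc zero`; with fewer than two,
-- resolving would be vacuous.
theorem4p1 n (s≤s (s≤s _)) = ¬finite⇒∞ λ t eq →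
  complete-unresolvable {u = zero} {v = suc zero} (λ ()) t (mpd-attained (complete n) eq)
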